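{- No algorithm can compute a spanning tree of an unweighted, undirected, connected graph with $m$ edges in time $o(m)$. Moreover, no algorithm can enumerate the edges of such a spanning tree with preprocessing in $o(m)$ and delay in $o(\overline{\Delta})$, where $\overline{\Delta}$ is the average degree of the graph.
   Context: Graphs $G=(V,E)$ have vertex set $V=\{1,\dots,n\}$ and $m=|E|$ edges. The average degree is $\overline{\Delta}=\frac1n\sum_{v\in V}\deg(v)$. A spanning tree of $G$ is a connected acyclic subgraph $T=(V,E')$ with $E'\subseteq E$ (so $|E'|=n-1$). Model: word RAM with word size in $\Omega(\log n)$. The graph is given by adjacency lists. The algorithm accesses the input by queries, each taking constant time: a degree query for a vertex $v$ returns the degree of $v$ (the length of its adjacency list); a neighbor query for $v$ returns the next, not yet returned entry of the adjacency list of $v$. The order of the entries in the lists is arbitrary. Enumeration: given the whole input graph, an enumeration algorithm must, for some single spanning tree $T$ of the graph, emit each edge of $T$ exactly once (one by one, irrevocably). It has preprocessing in $O(p)$ and delay in $O(d)$ if, on every input, after $O(p)$ computation steps of preprocessing, the worst-case time it needs to emit the respective next edge (including the first one after preprocessing) is in $O(d)$; similarly for $o(\cdot)$. The lower bounds are on worst-case complexity over all inputs. -}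

module Defs where

open import Data.Bool using (if_then_else_)
open import Data.Fin as Fin using (Fin; toℕ)
open import Data.Fin.Properties as Finₚ using ()
open import Data.Integer using (+_)
open import Data.List as List using (List; []; _∷_; _∷ʳ_; allFin; cartesianProduct; drop; filter; fromMaybe; head; length; _++_)
open import Data.List.Membership.Propositional using (_∈_)
open import Data.List.Relation.Unary.AllPairs using (AllPairs)
open import Data.List.Relation.Unary.Linked using (Linked)
open import Data.List.Relation.Unary.Unique.Propositional using (Unique)
open import Data.Maybe as Maybe using (Maybe; just; nothing; maybe′)
open import Data.Nat using (ℕ; zero; suc; _+_; _*_; _^_; _≤_; _<?_; _≡ᵇ_; NonZero)
open import Data.Nat.DivMod using (_/_; _mod_)
open import Data.Nat.ListAction using (sum)
open import Data.Nat.Logarithm using (⌈log₂_⌉)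
open import Data.Nat.Properties using (m^n≢0)
open import Data.Product using (_×_; _,_; proj₁; proj₂; Σ-syntax; ∃-syntax; swap)
import Data.Product as Product
open import Data.Rational.Unnormalised as ℚ using (ℚᵘ)
open import Data.Sum using (_⊎_)
open import Data.Vec as Vec using (Vec; []; _∷_; lookup; _[_]≔_)
open import Data.Vec.Functional using (updateAt)
open import Data.Vec.Properties using (≡-dec)
open import Function using (_⇔_)
open import Level using (0ℓ)
open import Relation.Binary using (Rel; Decidable; Symmetric; _⇒_)
open import Relation.Binary.Construct.Closure.ReflexiveTransitive using (Star)
open import Relation.Binary.PropositionalEquality using (_≡_)
open import Relation.Nullary using (¬_; does; yes; no; _×-dec_)

------------------------------------------------------------------------
-- Graphs

record Graph (n : ℕ) : Set₁ where
  field
    Adj    : Rel (Fin n) 0ℓ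
    adj?   : Decidable Adj
    sym    : Symmetric Adj
    irrefl : ∀ {v} → ¬ Adj v v

module _ {n : ℕ} (G : Graph n) where
  open Graph G

  edges : List (Fin n × Fin n)
  edges = filter (λ e → (proj₁ e Fin.<? proj₂ e) ×-dec adj? (proj₁ e) (proj₂ e))
                 (cartesianProduct (allFin n) (allFin n))

  edgeCount : ℕ
  edgeCount = length edges

  deg : Fin n → ℕ
  deg v = length (filter (adj? v) (allFin n))

  averageDegree : .{{NonZero n}} → ℚᵘ
  averageDegree = (+ sum (List.map deg (allFin n))) ℚ./ n

  Connected : Set
  Connected = ∀ u v → Star Adj u v

  -- The cycle visits v, then vs in order, then returns to v.
  IsCycle : Fin n → List (Fin n) → Set
  IsCycle v vs = 2 ≤ length vs × Unique (v ∷ vs) × Linked Adj (v ∷ vs ∷ʳ v)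

  Acyclic : Set
  Acyclic = ∀ v vs → ¬ IsCycle v vs

IsSpanningTree : ∀ {n} → Graph n → Graph n → Set
IsSpanningTree G T = (Graph.Adj T ⇒ Graph.Adj G) × Connected T × Acyclic T

SameEdge : ∀ {n} → Rel (Fin n × Fin n) 0ℓ
SameEdge e f = e ≡ f ⊎ e ≡ swap f

-- es contains every edge of T exactly once, in one of its two orientations,
-- and nothing else.
ListsEdges : ∀ {n} → Graph n → List (Fin n × Fin n) → Set
ListsEdges T es =
  AllPairs (λ e f → ¬ SameEdge e f) es ×
  (∀ u v → Graph.Adj T u v ⇔ ((u , v) ∈ es ⊎ (v , u) ∈ es))

------------------------------------------------------------------------
-- Inputs: connected graphs with arbitrarily ordered adjacency lists

record Input : Set₁ where
  field
    n           : ℕ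
    .{{n≢0}}    : NonZero n
    graph       : Graph n
    connected   : Connected graph
    neighbours  : Fin n → List (Fin n)
    unique      : ∀ v → Unique (neighbours v)
    complete    : ∀ u v → v ∈ neighbours u ⇔ Graph.Adj graph u v

m : Input → ℚᵘ
m x = (+ edgeCount (Input.graph x)) ℚ./ 1

Δ̄ : Input → ℚᵘ
Δ̄ x = averageDegree (Input.graph x)
  where open Input x

-- f ∈ o(g) for quantities depending on the input, as g → ∞, uniformly over
-- all inputs. Inputs on which g stays bounded do not constrain f.
_∈o_ : (Input → ℕ) → (Input → ℚᵘ) → Set₁
f ∈o g = ∀ ε → ℚ.0ℚᵘ ℚ.< ε →
         ∃[ N ] (∀ x → N ℚ.≤ g x → ((+ f x) ℚ./ 1) ℚ.≤ ε ℚ.* g x)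

_∈Ωlog : (ℕ → ℕ) → Set
w ∈Ωlog = ∃[ c ] ∃[ N ] (∀ n → N ≤ n → ⌈log₂ n ⌉ ≤ c * w n)

------------------------------------------------------------------------
-- Word RAM with query access to the input

Word : ℕ → Set
Word w = Fin (2 ^ w)

toWord : ∀ w → ℕ → Word w
toWord w a = (a mod (2 ^ w)) {{m^n≢0 2 w}}

-- Since the word size is only Ω(log n), a vertex may need several (but
-- constantly many) words: numbers are stored in k words, least significant
-- first, and reduced modulo 2 ^ (w * k).
encode : ∀ w k → ℕ → Vec (Word w) k
encode w zero    a = []
encode w (suc k) a = toWord w a ∷ encode w k ((a / (2 ^ w)) {{m^n≢0 2 w}})

decode : ∀ w {k} → Vec (Word w) k → ℕ
decode w []       = 0
decode w (a ∷ as) = toℕ a + 2 ^ w * decode w as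

-- The instruction set is not fixed: a program may use any operations on
-- words (constants, arithmetic, shifts, bitwise logic, comparisons, …) at unit
-- cost. An operation is given for all word sizes at once.
WordOp : Set
WordOp = ∀ w → Word w → Word w → Word w

-- r registers; addresses and vertices occupy k registers.
data Instr (r k : ℕ) : Set where
  op        : WordOp → (dst src₁ src₂ : Fin r) → Instr r k
  load      : (dst : Fin r) (addr : Vec (Fin r) k) → Instr r k
  store     : (addr : Vec (Fin r) k) (src : Fin r) → Instr r k
  jumpZero  : (src : Fin r) (target : ℕ) → Instr r k
  order     : (dst : Vec (Fin r) k) → Instr r k
  degree    : (dst vertex : Vec (Fin r) k) → Instr r k
  neighbour : (dst vertex : Vec (Fin r) k) → Instr r k
  emit      : (u v : Vec (Fin r) k) → Instr r k

record Program : Set where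
  field
    r k  : ℕ
    code : List (Instr r k)

-- The vertex set is {1,…,n} for the program; 0 is never a vertex.
label : ∀ {n} → Fin n → ℕ
label v = suc (toℕ v)

fromLabel : ∀ n → ℕ → Maybe (Fin n)
fromLabel n zero    = nothing
fromLabel n (suc a) with a <? n
... | yes a<n = just (Fin.fromℕ< a<n)
... | no  _   = nothing

module Execution (wordSize : ℕ → ℕ) (P : Program) (x : Input) where
  open Program P
  open Input x

  w : ℕ
  w = wordSize n

  record State : Set where
    constructor state
    field
      pc     : ℕ
      regs   : Vec (Word w) r
      memory : Vec (Word w) k → Word w
      unread : Fin n → List (Fin n)  -- entries not yet returned by queries

  open State

  start : State
  start = state 0 (Vec.replicate r (toWord w 0)) (λ _ → toWord w 0) neighbours

  read : Vec (Word w) r → Vec (Fin r) k → Vec (Word w) k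
  read ρ = Vec.map (lookup ρ)

  write : ∀ {l} → Vec (Fin r) l → Vec (Word w) l → Vec (Word w) r → Vec (Word w) r
  write []       []       ρ = ρ
  write (i ∷ is) (a ∷ as) ρ = write is as (ρ [ i ]≔ a)

  writeℕ : Vec (Fin r) k → ℕ → Vec (Word w) r → Vec (Word w) r
  writeℕ is a = write is (encode w k a)

  vertexAt : Vec (Word w) r → Vec (Fin r) k → Maybe (Fin n)
  vertexAt ρ is = fromLabel n (decode w (read ρ is))

  -- Queries to something that is not a vertex, and neighbour queries to an
  -- exhausted list, return 0.
  exec : Instr r k → State → State × Maybe (ℕ × ℕ)
  exec (op f i j l) (state p ρ μ q) =
    state (suc p) (ρ [ i ]≔ f w (lookup ρ j) (lookup ρ l)) μ q , nothing
  exec (load i a) (state p ρ μ q) =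
    state (suc p) (ρ [ i ]≔ μ (read ρ a)) μ q , nothing
  exec (store a i) (state p ρ μ q) =
    state (suc p) ρ
      (λ b → if does (≡-dec Finₚ._≟_ b (read ρ a)) then lookup ρ i else μ b) q
    , nothing
  exec (jumpZero i t) (state p ρ μ q) =
    state (if toℕ (lookup ρ i) ≡ᵇ 0 then t else suc p) ρ μ q , nothing
  exec (order is) (state p ρ μ q) =
    state (suc p) (writeℕ is n ρ) μ q , nothing
  exec (degree is a) (state p ρ μ q) =
    state (suc p)
      (writeℕ is (maybe′ (λ v → length (neighbours v)) 0 (vertexAt ρ a)) ρ) μ q
    , nothing
  exec (neighbour is a) (state p ρ μ q) with vertexAt ρ a
  ... | nothing = state (suc p) (writeℕ is 0 ρ) μ q , nothing
  ... | just v  =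
    state (suc p) (writeℕ is (maybe′ label 0 (head (q v))) ρ) μ
      (updateAt q v (drop 1))
    , nothing
  exec (emit a b) (state p ρ μ q) =
    state (suc p) ρ μ q , just (decode w (read ρ a) , decode w (read ρ b))

  fetch : State → Maybe (Instr r k)
  fetch s = head (drop (pc s) code)

  -- A program halts by running or jumping past the end of its code.
  Halted : State → Set
  Halted s = fetch s ≡ nothing

  step : State → State × Maybe (ℕ × ℕ)
  step s = maybe′ (λ i → exec i s) (s , nothing) (fetch s)

  after : ℕ → State → State
  after zero    s = s
  after (suc t) s = after t (proj₁ (step s))

  emitted : ℕ → State → List (ℕ × ℕ)
  emitted zero    s = []
  emitted (suc t) s = fromMaybe (proj₂ (step s)) ++ emitted t (proj₁ (step s))

  -- The pairs of numbers os are the edges of one spanning tree of the input.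
  SpanningTreeOutput : List (ℕ × ℕ) → Set₁
  SpanningTreeOutput os =
    Σ[ T ∈ Graph n ] ∃[ es ]
      IsSpanningTree graph T × ListsEdges T es ×
      os ≡ List.map (Product.map label label) es

  ComputesSpanningTreeIn : ℕ → Set₁
  ComputesSpanningTreeIn t =
    Halted (after t start) × SpanningTreeOutput (emitted t start)

  -- From s on, exactly the pairs os are emitted, each at most d steps after
  -- the previous one (the first one at most d steps after s).
  data EmitsWithDelay (d : ℕ) (s : State) : List (ℕ × ℕ) → Set where
    done : (∀ t → emitted t s ≡ []) → EmitsWithDelay d s []
    next : ∀ t {o os} → suc t ≤ d →
           emitted t s ≡ [] →
           proj₂ (step (after t s)) ≡ just o →
           EmitsWithDelay d (after (suc t) s) os →
           EmitsWithDelay d s (o ∷ os)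

  EnumeratesSpanningTree : (preprocessing delay : ℕ) → Set₁
  EnumeratesSpanningTree p d =
    emitted p start ≡ [] ×
    ∃[ os ] SpanningTreeOutput os × EmitsWithDelay d (after p start) os

open Execution public using (ComputesSpanningTreeIn; EnumeratesSpanningTree)

ComputesInTimeo[m] : (ℕ → ℕ) → Program → Set₁
ComputesInTimeo[m] w P =
  Σ[ time ∈ (Input → ℕ) ]
    time ∈o m ×
    (∀ x → ComputesSpanningTreeIn w P x (time x))

EnumeratesWithPreprocessingo[m]Delayo[Δ̄] : (ℕ → ℕ) → Program → Set₁
EnumeratesWithPreprocessingo[m]Delayo[Δ̄] w P =
  Σ[ preprocessing ∈ (Input → ℕ) ] Σ[ delay ∈ (Input → ℕ) ]
    preprocessing ∈o m ×
    delay ∈o Δ̄ ×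
    (∀ x → EnumeratesSpanningTree w P x (preprocessing x) (delay x))

{-# OPTIONS --safe #-}

-- An adversary argument. Take two disjoint copies ("sheets") of K_{s+1,s+1} and twist one edge ij:
-- replace its two copies by the edges from i in either sheet to j in the other. Degrees do not
-- depend on ij, and a neighbour query distinguishes the twist of ij from the untwisted graph only
-- if it returns an entry of a list of i or j that belongs to ij. So after t < s² − 1 steps at least
-- two twists are possible, and the output so far is the same for both. But it cannot be complete:
-- a spanning tree has an edge between the sheets, and such an edge reveals ij. Since m ≤ n² is in
-- O(s²), time o(m) is too short. Enumeration of the at most n tree edges takes p + n·d steps, and
-- n·Δ̄ = 2m is in O(s²) as well.
module Submission where

open import Defs
open import Data.Bool using (Bool; true; false; not; _xor_; if_then_else_)
import Data.Bool.Properties as Bool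
open import Data.Bool.Properties using (xor-identityʳ; xor-assoc; xor-same; xor-comm; not-involutive; not-¬)
open import Data.Fin as Fin using (Fin; zero; suc; toℕ; fromℕ<)
import Data.Fin.Properties as Fin
open import Data.Fin.Properties using (_≟_; *↔×; 2↔Bool; toℕ-fromℕ<; toℕ-injective)
open import Data.Integer as ℤ using (+_; -[1+_])
import Data.Integer.Properties as ℤ
open import Data.List as List using (List; []; _∷_; _∷ʳ_; _++_; length; filter; allFin; tabulate; cartesianProduct; drop; head; fromMaybe)
open import Data.List.Membership.Propositional using (_∈_; _∉_; find; lose)
import Data.List.Membership.DecPropositional as DecMembership
open import Data.List.Membership.Propositional.Properties using (∈-∃++; ∈-++⁺ˡ; ∈-++⁺ʳ; ∈-++⁻; ∈-filter⁺; ∈-allFin; ∈-tabulate⁺; ∈-tabulate⁻; ∈-cartesianProduct⁺; ∈-map⁺; ∈-map⁻)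
open import Data.List.Properties using (length-++; length-map; length-tabulate; length-filter; filter-notAll; drop-drop; ++-assoc; ++-identityʳ)
open import Data.List.Relation.Unary.All as All using (All)
open import Data.List.Relation.Unary.All.Properties using (¬Any⇒All¬)
open import Data.List.Relation.Unary.AllPairs using (AllPairs; []; _∷_)
open import Data.List.Relation.Unary.Any using (here; there; any?)
open import Data.List.Relation.Unary.Linked using (Linked; [-]; _∷_)
open import Data.List.Relation.Unary.Unique.Propositional using (Unique)
import Data.List.Relation.Unary.Unique.Propositional.Properties as Unique
open import Data.Maybe using (Maybe; just; nothing; maybe′)
open import Data.Nat using (ℕ; zero; suc; _+_; _*_; _≤_; _<_; z≤n; s≤s; _<?_; _≡ᵇ_)
open import Data.Nat.ListAction using (sum)
open import Data.Nat.Properties using (module ≤-Reasoning; ≤-refl; ≤-reflexive; ≤-trans; ≤⇒≯; ≮⇒≥; n≤1+n; m≤m+n; m≤n+m; m≤m*n; m+n≤o⇒m≤o; m≤n⇒∃[o]m+o≡n; suc-injective; +-suc; +-comm; +-monoˡ-≤; +-monoʳ-≤; +-mono-≤; +-cancelˡ-≤; *-assoc; *-comm; *-identityʳ; *-monoˡ-≤; *-mono-≤; *-cancelˡ-≤)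
open import Data.Nat.Tactic.RingSolver using (solve-∀)
open import Data.Product as Product using (_×_; _,_; proj₁; proj₂; ∃-syntax; Σ-syntax)
open import Data.Product.Function.NonDependent.Propositional using (_×-↔_)
import Data.Product.Properties as Product
open import Data.Rational.Unnormalised as ℚ using (ℚᵘ; mkℚᵘ)
open import Data.Sum using (_⊎_; inj₁; inj₂; [_,_]′)
open import Data.Vec as Vec using (Vec; []; _∷_; lookup; _[_]≔_)
open import Data.Vec.Functional using (updateAt)
open import Data.Vec.Functional.Properties using (updateAt-updates; updateAt-minimal)
open import Data.Vec.Properties using (≡-dec)
open import Function using (_∘_; _↔_; Inverse; Equivalence; mk⇔)
open import Function.Properties.Inverse using (↔-trans; ↔-refl)
open import Level using (0ℓ)
open import Relation.Binary using (Rel; DecidableEquality; _⇒_)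
open import Relation.Binary.Construct.Closure.ReflexiveTransitive as Star using (Star; ε; _◅_; _◅◅_)
open import Relation.Binary.PropositionalEquality using (_≡_; _≢_; refl; sym; trans; cong; cong₂; subst; subst₂)
open import Relation.Nullary using (¬_; does; yes; no; contradiction; ¬?)
open import Relation.Nullary.Decidable using (dec-false; dec-true; decidable-stable; _×-dec_)

-- Counting in duplicate-free lists

-- Pigeonhole by induction: one occurrence of `x` is cut out of `ys`, and the rest of `xs`, which
-- avoids `x`, survives the cut.
unique⇒length-mono : ∀ {A : Set} {xs ys : List A} → Unique xs →
                     (∀ {x} → x ∈ xs → x ∈ ys) → length xs ≤ length ys
unique⇒length-mono {xs = []} [] _ = z≤n
unique⇒length-mono {xs = x ∷ xs} (x∉ ∷ u) sub with ∈-∃++ (sub (here refl))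
... | as , bs , refl = begin
  suc (length xs)             ≤⟨ s≤s (unique⇒length-mono u sub′) ⟩
  suc (length (as ++ bs))     ≡⟨ cong suc (length-++ as) ⟩
  suc (length as + length bs) ≡⟨ +-suc (length as) (length bs) ⟨
  length as + suc (length bs) ≡⟨ length-++ as ⟨
  length (as ++ x ∷ bs)       ∎
  where
  open ≤-Reasoning
  sub′ : ∀ {y} → y ∈ xs → y ∈ as ++ bs
  sub′ y∈ with ∈-++⁻ as (sub (there y∈))
  ... | inj₁ y∈as          = ∈-++⁺ˡ y∈as
  ... | inj₂ (here refl)   = contradiction refl (All.lookup x∉ y∈)
  ... | inj₂ (there y∈bs)  = ∈-++⁺ʳ as y∈bs

fresh-element : ∀ {A : Set} → DecidableEquality A → (xs hs : List A) → Unique xs →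
                length hs < length xs → ∃[ x ] x ∈ xs × x ∉ hs
fresh-element dec xs hs u hs<xs with any? (λ x → ¬? (x ∈? hs)) xs
  where open DecMembership dec using (_∈?_)
... | yes some = find some
... | no  none = contradiction hs<xs (≤⇒≯ (unique⇒length-mono u covered))
  where
  open DecMembership dec using (_∈?_)
  covered : ∀ {x} → x ∈ xs → x ∈ hs
  covered {x} x∈xs with x ∈? hs
  ... | yes x∈hs = x∈hs
  ... | no  x∉hs = contradiction (lose x∈xs x∉hs) none

-- Walks and simple paths

-- The first step of the walk that changes the value of `f` is the one sought. With `f` the sheet,
-- this finds a tree edge between the sheets.
crossing : ∀ {A B : Set} {R : Rel A 0ℓ} → DecidableEquality B → (f : A → B) → ∀ {u v} →
           Star R u v → f u ≢ f v → ∃[ x ] ∃[ y ] R x y × f x ≢ f y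
crossing dec f ε fu≢fv = contradiction refl fu≢fv
crossing dec f {u} (_◅_ {j = x} e p) fu≢fv with dec (f u) (f x)
... | yes fu≡fx = crossing dec f p (fu≢fv ∘ trans fu≡fx)
... | no  fu≢fx = u , x , e , fu≢fx

-- The list omits the start vertex, so that start and list have the shape that `IsCycle` expects.
data SimplePath {A : Set} (R : Rel A 0ℓ) (v : A) : A → List A → Set where
  []  : SimplePath R v v []
  _∷⟨_⟩_ : ∀ {u x ws} → R u x → u ∉ x ∷ ws → SimplePath R v x ws → SimplePath R v u (x ∷ ws)

module _ {A : Set} {R : Rel A 0ℓ} where

  suffix-from : ∀ {u v x ws} → SimplePath R v x ws → u ∈ x ∷ ws → ∃[ us ] SimplePath R v u us
  suffix-from p (here refl) = _ , p
  suffix-from (_ ∷⟨ _ ⟩ p) (there u∈) = suffix-from p u∈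

  simplify : DecidableEquality A → ∀ {u v} → Star R u v → ∃[ ws ] SimplePath R v u ws
  simplify dec ε = [] , []
  simplify dec {u} (_◅_ {j = x} e p) with simplify dec p
  ... | ws , q with u ∈? (x ∷ ws)
    where open DecMembership dec using (_∈?_)
  ... | yes u∈ = suffix-from q u∈
  ... | no  u∉ = x ∷ ws , e ∷⟨ u∉ ⟩ q

  simplePath⇒unique : ∀ {u v ws} → SimplePath R v u ws → Unique (u ∷ ws)
  simplePath⇒unique [] = All.[] ∷ []
  simplePath⇒unique (_ ∷⟨ u∉ ⟩ p) = ¬Any⇒All¬ _ u∉ ∷ simplePath⇒unique p

  simplePath⇒linked : ∀ {S : Rel A 0ℓ} {u v z ws} → R ⇒ S → S v z →
                      SimplePath R v u ws → Linked S (u ∷ ws ∷ʳ z)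
  simplePath⇒linked f e [] = e ∷ [-]
  simplePath⇒linked f e (r ∷⟨ _ ⟩ p) = f r ∷ simplePath⇒linked f e p

-- Forests have at most as many edges as vertices

ListedEdge : ∀ {n} → List (Fin n × Fin n) → Rel (Fin n) 0ℓ
ListedEdge es u v = (u , v) ∈ es ⊎ (v , u) ∈ es

module _ {n : ℕ} (T : Graph n) (acyclic : Acyclic T) where
  open Graph T using (Adj; irrefl)

  -- A simple path of at least two edges would close to a cycle with `uv`; a shorter one would be a
  -- loop or the edge `uv` itself.
  acyclic⇒separated : ∀ {u v es} → ListedEdge es ⇒ Adj → Adj u v → ¬ ListedEdge es u v →
                      ¬ Star (ListedEdge es) u v
  acyclic⇒separated {u} {v} sub uv new p with simplify _≟_ p
  ... | _ , []                           = irrefl uv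
  ... | _ , r ∷⟨ _ ⟩ []                  = new r
  ... | ws , q@(_ ∷⟨ _ ⟩ (_ ∷⟨ _ ⟩ _))   =
    acyclic u ws (s≤s (s≤s z≤n) , simplePath⇒unique q , simplePath⇒linked sub (Graph.sym T uv) q)

  -- Vertices of equal colour are connected by es. By acyclicity every added edge merges two colours.
  colouring : (es : List (Fin n × Fin n)) → AllPairs (λ e f → ¬ SameEdge e f) es →
              ListedEdge es ⇒ Adj →
              Σ[ c ∈ (Fin n → Fin n) ] ∃[ cs ]
                (∀ v → c v ∈ cs) × (∀ u v → c u ≡ c v → Star (ListedEdge es) u v) ×
                length es + length cs ≤ n
  colouring [] _ _ = (λ v → v) , allFin n , ∈-allFin , (λ { u .u refl → ε }) ,
                     ≤-reflexive (length-tabulate (λ v → v))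
  colouring ((a , b) ∷ es) (ab∉ ∷ ps) sub = c′ , cs′ , c′∈ , joined , count
    where
    sub′ : ListedEdge es ⇒ Adj
    sub′ = sub ∘ [ inj₁ ∘ there , inj₂ ∘ there ]′
    rec = colouring es ps sub′
    c = proj₁ rec
    cs = proj₁ (proj₂ rec)
    c∈ = proj₁ (proj₂ (proj₂ rec))
    conn = proj₁ (proj₂ (proj₂ (proj₂ rec)))
    bound = proj₂ (proj₂ (proj₂ (proj₂ rec)))
    new : ¬ ListedEdge es a b
    new (inj₁ ab∈) = All.lookup ab∉ ab∈ (inj₁ refl)
    new (inj₂ ba∈) = All.lookup ab∉ ba∈ (inj₂ refl)
    ca≢cb : c a ≢ c b
    ca≢cb eq = acyclic⇒separated sub′ (sub (inj₁ (here refl))) new (conn a b eq)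
    merge : Fin n → Fin n
    merge k with k ≟ c a
    ... | yes _ = c b
    ... | no  _ = k
    c′ : Fin n → Fin n
    c′ v = merge (c v)
    cs′ = filter (λ k → ¬? (k ≟ c a)) cs
    c′∈ : ∀ v → c′ v ∈ cs′
    c′∈ v with c v ≟ c a
    ... | yes _   = ∈-filter⁺ (λ k → ¬? (k ≟ c a)) (c∈ b) (ca≢cb ∘ sym)
    ... | no  ne  = ∈-filter⁺ (λ k → ¬? (k ≟ c a)) (c∈ v) ne
    conn′ : ∀ u v → c u ≡ c v → Star (ListedEdge ((a , b) ∷ es)) u v
    conn′ u v eq = Star.map [ inj₁ ∘ there , inj₂ ∘ there ]′ (conn u v eq)
    joined : ∀ u v → c′ u ≡ c′ v → Star (ListedEdge ((a , b) ∷ es)) u v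
    joined u v eq with c u ≟ c a | c v ≟ c a
    ... | yes p | yes q = conn′ u v (trans p (sym q))
    ... | yes p | no  _ = conn′ u a p ◅◅ inj₁ (here refl) ◅ conn′ b v eq
    ... | no  _ | yes q = conn′ u b eq ◅◅ inj₂ (here refl) ◅ conn′ a v (sym q)
    ... | no  _ | no  _ = conn′ u v eq
    -- The colour `c a` disappears, which pays for the added edge.
    count : suc (length es) + length cs′ ≤ n
    count = ≤-trans (≤-reflexive (sym (+-suc (length es) (length cs′))))
              (≤-trans (+-monoʳ-≤ (length es) (filter-notAll _ cs (lose (c∈ a) (λ ne → ne refl)))) bound)

  forest-size : ∀ {es} → ListsEdges T es → length es ≤ n
  forest-size {es} (ps , adj) with colouring es ps (λ {u} {v} → Equivalence.from (adj u v))
  ... | _ , cs , _ , _ , bound = ≤-trans (m≤m+n (length es) (length cs)) bound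

-- Bounds on degrees and edge counts

length-cartesianProduct : ∀ {A B : Set} (xs : List A) (ys : List B) →
                          length (cartesianProduct xs ys) ≡ length xs * length ys
length-cartesianProduct []       ys = refl
length-cartesianProduct (x ∷ xs) ys =
  trans (length-++ (List.map (x ,_) ys))
        (cong₂ _+_ (length-map (x ,_) ys) (length-cartesianProduct xs ys))

module _ {n : ℕ} (G : Graph n) where
  open Graph G using (Adj; adj?)

  deg≤size : ∀ v → deg G v ≤ n
  deg≤size v = ≤-trans (length-filter (adj? v) (allFin n)) (≤-reflexive (length-tabulate (λ i → i)))

  edgeCount≤size² : edgeCount G ≤ n * n
  edgeCount≤size² = ≤-trans (length-filter _ (cartesianProduct (allFin n) (allFin n)))
    (≤-reflexive (trans (length-cartesianProduct (allFin n) (allFin n))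
      (cong (λ k → k * k) (length-tabulate {n = n} (λ i → i)))))

  distinctNeighbours≤deg : ∀ {v vs} → Unique vs → (∀ {u} → u ∈ vs → Adj v u) → length vs ≤ deg G v
  distinctNeighbours≤deg {v} u adj =
    unique⇒length-mono u (λ u∈ → ∈-filter⁺ (adj? v) (∈-allFin _) (adj u∈))

sum-bounds : ∀ {A : Set} (f : A → ℕ) {a b} → (∀ x → a ≤ f x) → (∀ x → f x ≤ b) →
             ∀ xs → length xs * a ≤ sum (List.map f xs) × sum (List.map f xs) ≤ length xs * b
sum-bounds f lo hi []       = z≤n , z≤n
sum-bounds f lo hi (x ∷ xs) with sum-bounds f lo hi xs
... | l , h = +-mono-≤ (lo x) l , +-mono-≤ (hi x) h

module _ {n : ℕ} (G : Graph (suc n)) where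
  open Graph G using (Adj; adj?; irrefl)

  -- Since `zero` is the least vertex, the pairs `(zero , u)` are already oriented as in `edges`.
  distinctNeighbours≤edgeCount : ∀ {vs} → Unique vs → (∀ {u} → u ∈ vs → Adj zero u) →
                                 length vs ≤ edgeCount G
  distinctNeighbours≤edgeCount {vs} u adj =
    ≤-trans (≤-reflexive (sym (length-map (zero ,_) vs)))
      (unique⇒length-mono (Unique.map⁺ Product.,-injectiveʳ u) inEdges)
    where
    inEdges : ∀ {e} → e ∈ List.map (zero ,_) vs → e ∈ edges G
    inEdges e∈ with ∈-map⁻ (zero ,_) e∈
    ... | zero  , v∈ , refl = contradiction (adj v∈) irrefl
    ... | suc v , v∈ , refl =
      ∈-filter⁺ (λ e → (proj₁ e Fin.<? proj₂ e) ×-dec adj? (proj₁ e) (proj₂ e))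
        (∈-cartesianProduct⁺ (∈-allFin zero) (∈-allFin (suc v))) (s≤s z≤n , adj v∈)

-- The twisted double covers of the complete bipartite graph

-- A vertex consists of its side in the bipartition, its sheet and its index. The twisted edge avoids
-- the vertices of index 0, so that these connect each sheet.
module DoubleCover (s : ℕ) where

  Index = Fin (suc s)
  Vertex = Bool × Bool × Index
  BaseEdge = Index × Index
  Twist = Fin s × Fin s

  size : ℕ
  size = 2 * (2 * suc s)

  opaque
    coding : Fin size ↔ Vertex
    coding = ↔-trans *↔× (2↔Bool ×-↔ ↔-trans *↔× (2↔Bool ×-↔ ↔-refl))

  open Inverse coding public using () renaming (to to coords; from to code)

  coords-code : ∀ u → coords (code u) ≡ u
  coords-code = Inverse.strictlyInverseˡ coding

  code-coords : ∀ u → code (coords u) ≡ u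
  code-coords = Inverse.strictlyInverseʳ coding

  sheet : Vertex → Bool
  sheet (_ , α , _) = α

  index : Vertex → Index
  index (_ , _ , i) = i

  _≟ᵥ_ : DecidableEquality Vertex
  _≟ᵥ_ = Product.≡-dec Bool._≟_ (Product.≡-dec Bool._≟_ _≟_)

  _≟ₑ_ : DecidableEquality BaseEdge
  _≟ₑ_ = Product.≡-dec _≟_ _≟_

  twisted : Twist → BaseEdge
  twisted = Product.map suc suc

  -- The index on side `false` comes first, so both ends of an edge name the same base edge.
  baseEdge : Bool → Index → Index → BaseEdge
  baseEdge false i j = i , j
  baseEdge true  i j = j , i

  baseEdge-not : ∀ a i j → baseEdge (not a) j i ≡ baseEdge a i j
  baseEdge-not false i j = refl
  baseEdge-not true  i j = refl

  flips : Twist → BaseEdge → Bool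
  flips e f = does (f ≟ₑ twisted e)

  -- The one neighbour of a vertex that has index `j`. The `xor` changes the sheet exactly on the
  -- twisted edge.
  link : Twist → Vertex → Index → Vertex
  link e (a , α , i) j = not a , α xor flips e (baseEdge a i j) , j

  -- Both directions have the same base edge, so the sheet is flipped twice or not at all. This
  -- gives symmetry of adjacency.
  link-link : ∀ e u j → link e (link e u j) (index u) ≡ u
  link-link e (a , α , i) j rewrite baseEdge-not a i j | not-involutive a
    | xor-assoc α (flips e (baseEdge a i j)) (flips e (baseEdge a i j))
    | xor-same (flips e (baseEdge a i j)) | xor-identityʳ α = refl

  graphOf : Twist → Graph size
  graphOf e = record
    { Adj    = λ u v → coords v ≡ link e (coords u) (index (coords v))
    ; adj?   = λ u v → coords v ≟ᵥ link e (coords u) (index (coords v))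
    ; sym    = λ {u} {v} eq → trans (sym (link-link e (coords u) (index (coords v))))
                                    (cong (λ x → link e x (index (coords u))) (sym eq))
    ; irrefl = λ {u} eq → not-¬ refl (cong proj₁ eq)
    }

  -- The order by index is the adversary's choice: side and index of each entry are known in
  -- advance, and only its sheet depends on the twist.
  neighboursOf : Twist → Fin size → List (Fin size)
  neighboursOf e u = tabulate (λ j → code (link e (coords u) j))

  neighboursOf-unique : ∀ e u → Unique (neighboursOf e u)
  neighboursOf-unique e u = Unique.tabulate⁺ λ {i} {j} eq →
    cong index (trans (sym (coords-code (link e (coords u) i)))
               (trans (cong coords eq) (coords-code (link e (coords u) j))))

  neighboursOf-sound : ∀ e {u v} → v ∈ neighboursOf e u → Graph.Adj (graphOf e) u v
  neighboursOf-sound e {u} {v} v∈ with ∈-tabulate⁻ {f = λ j → code (link e (coords u) j)} v∈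
  ... | j , refl rewrite coords-code (link e (coords u) j) = refl

  neighboursOf-complete : ∀ e {u v} → Graph.Adj (graphOf e) u v → v ∈ neighboursOf e u
  neighboursOf-complete e {u} {v} eq =
    subst (_∈ neighboursOf e u) (trans (cong code (sym eq)) (code-coords v))
      (∈-tabulate⁺ {f = λ j → code (link e (coords u) j)} (index (coords v)))

  unflipped : ∀ e u j → baseEdge (proj₁ u) (index u) j ≢ twisted e → sheet (link e u j) ≡ sheet u
  unflipped e (a , α , i) j ne =
    trans (cong (α xor_) (dec-false (baseEdge a i j ≟ₑ twisted e) ne)) (xor-identityʳ α)

  module _ (e : Twist) where
    private
      _~_ : Vertex → Vertex → Set
      u ~ v = Star (λ x y → y ≡ link e x (index y)) u v

      edge : ∀ u j → u ~ link e u j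
      edge u j = refl ◅ ε

      reverse : ∀ {u v} → u ~ v → v ~ u
      reverse = Star.reverse λ {u} {v} eq →
        trans (sym (link-link e u (index v))) (cong (λ x → link e x (index u)) (sym eq))

      hub : Bool → Bool → Vertex
      hub a α = a , α , zero

      toHub : ∀ a α i → (a , α , i) ~ hub (not a) α
      toHub a α i = subst ((a , α , i) ~_)
        (cong (λ β → not a , β , zero) (unflipped e (a , α , i) zero (untwisted a i)))
        (edge (a , α , i) zero)
        where
        untwisted : ∀ a i → baseEdge a i zero ≢ twisted e
        untwisted false i ()
        untwisted true  i ()

      swapSide : ∀ a α → hub a α ~ hub (not a) α
      swapSide a α = toHub a α zero

      swapSheet : ∀ α → hub false α ~ hub false (not α)
      swapSheet α =
        -- From the hub to the end `suc j` of the twisted edge, across it into the other sheet, and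
        -- back to the hub of that sheet.
        reverse (toHub true α (suc j)) ◅◅ reverse flip ◅◅
        toHub false (not α) (suc i) ◅◅ swapSide true (not α)
        where
        i = proj₁ e
        j = proj₂ e
        flipped : not α xor flips e (suc i , suc j) ≡ α
        flipped = trans (cong (not α xor_) (dec-true ((suc i , suc j) ≟ₑ twisted e) refl))
                        (trans (xor-comm (not α) true) (not-involutive α))
        flip : (false , not α , suc i) ~ (true , α , suc j)
        flip = subst ((false , not α , suc i) ~_) (cong (λ β → true , β , suc j) flipped)
                     (edge (false , not α , suc i) (suc j))

      rootHub : ∀ α → hub false false ~ hub false α
      rootHub false = ε
      rootHub true  = swapSheet false

      root : ∀ u → hub false false ~ u
      root (true  , α , i) = rootHub α ◅◅ reverse (toHub true α i)
      root (false , α , i) = rootHub α ◅◅ swapSide false α ◅◅ reverse (toHub false α i)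

    graphOf-connected : Connected (graphOf e)
    graphOf-connected u v = subst₂ (Star (Graph.Adj (graphOf e))) (code-coords u) (code-coords v)
      (Star.gmap code lift (reverse (root (coords u)) ◅◅ root (coords v)))
      where
      lift : ∀ {x y} → y ≡ link e x (index y) → Graph.Adj (graphOf e) (code x) (code y)
      lift {x} {y} eq rewrite coords-code x | coords-code y = eq

  inputOf : Twist → Input
  inputOf e = record
    { n          = size
    ; graph      = graphOf e
    ; connected  = graphOf-connected e
    ; neighbours = neighboursOf e
    ; unique     = neighboursOf-unique e
    ; complete   = λ u v → mk⇔ (neighboursOf-sound e) (neighboursOf-complete e)
    }

-- Runs on different twists are indistinguishable

head-drop-tabulate : ∀ {A : Set} {k} (f : Fin k → A) i → head (drop (toℕ i) (tabulate f)) ≡ just (f i)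
head-drop-tabulate f zero    = refl
head-drop-tabulate f (suc i) = head-drop-tabulate (f ∘ suc) i

head-drop-all : ∀ {A : Set} c (xs : List A) → length xs ≤ c → head (drop c xs) ≡ nothing
head-drop-all zero    []       _       = refl
head-drop-all (suc c) []       _       = refl
head-drop-all (suc c) (x ∷ xs) (s≤s p) = head-drop-all c xs p

module _ (s : ℕ) where
  open DoubleCover s

  -- h collects the base edges that the query reveals to be twisted or not.
  nextNeighbour : ∀ u c → ∃[ h ] Σ[ next ∈ Maybe (Fin size) ] length h ≤ 1 ×
    (∀ e → twisted e ∉ h → head (drop c (neighboursOf e u)) ≡ next)
  nextNeighbour u c with c <? suc s
  ... | yes c<s = baseEdge (proj₁ (coords u)) (index (coords u)) j ∷ [] ,
                  just (code (not (proj₁ (coords u)) , sheet (coords u) , j)) , ≤-refl , same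
    where
    j = fromℕ< c<s
    same : ∀ e → twisted e ∉ _ → head (drop c (neighboursOf e u)) ≡ _
    same e e∉ = trans
      (subst (λ k → head (drop k (neighboursOf e u)) ≡ just (code (link e (coords u) j)))
             (toℕ-fromℕ< c<s) (head-drop-tabulate (λ j → code (link e (coords u) j)) j))
      (cong (λ α → just (code (not (proj₁ (coords u)) , α , j)))
            (unflipped e (coords u) j (e∉ ∘ here ∘ sym)))
  ... | no c≮s = [] , nothing , z≤n , λ e _ →
    head-drop-all c (neighboursOf e u)
      (≤-trans (≤-reflexive (length-tabulate (λ j → code (link e (coords u) j)))) (≮⇒≥ c≮s))

module _ (wordSize : ℕ → ℕ) (P : Program) (x : Input) where
  open Execution wordSize P x
  open Program P using (r; k)

  -- The case distinction in `exec` blocks until the queried vertex is known; this equation and the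
  -- next one resolve it.
  exec-neighbour-nothing : ∀ is a ρ {p μ q} → vertexAt ρ a ≡ nothing →
    exec (neighbour is a) (state p ρ μ q) ≡ (state (suc p) (writeℕ is 0 ρ) μ q , nothing)
  exec-neighbour-nothing is a ρ eq with vertexAt ρ a | eq
  ... | nothing | refl = refl

  exec-neighbour-just : ∀ is a ρ {p μ q v} → vertexAt ρ a ≡ just v →
    exec (neighbour is a) (state p ρ μ q) ≡
      (state (suc p) (writeℕ is (maybe′ label 0 (head (q v))) ρ) μ (updateAt q v (drop 1)) , nothing)
  exec-neighbour-just is a ρ eq with vertexAt ρ a | eq
  ... | just v | refl = refl

module Simulation (wordSize : ℕ → ℕ) (P : Program) (s : ℕ) where
  open Program P using (r; k)
  open DoubleCover s

  W : ℕ
  W = wordSize size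

  module Run (e : Twist) = Execution wordSize P (inputOf e)

  -- The part of a state that does not depend on the input: in place of the unread entries of the
  -- adjacency lists it has the numbers of entries read.
  record Snapshot : Set where
    constructor snapshot
    field
      pc     : ℕ
      regs   : Vec (Word W) r
      memory : Vec (Word W) k → Word W
      read   : Fin size → ℕ

  unreadAfter : Twist → (Fin size → ℕ) → Fin size → List (Fin size)
  unreadAfter e c u = drop (c u) (neighboursOf e u)

  -- The unread lists are compared pointwise, since equality of the functions would require
  -- extensionality.
  data Matches (e : Twist) : Snapshot → Run.State e → Set where
    matches : ∀ {p ρ μ c q} → (∀ u → q u ≡ unreadAfter e c u) →
              Matches e (snapshot p ρ μ c) (Run.state p ρ μ q)

  -- Run.write e blocks on the list of registers, so it is not definitionally independent of e.
  write : ∀ {l} → Vec (Fin r) l → Vec (Word W) l → Vec (Word W) r → Vec (Word W) r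
  write []       []       ρ = ρ
  write (i ∷ is) (a ∷ as) ρ = write is as (ρ [ i ]≔ a)

  write≡ : ∀ e {l} (is : Vec (Fin r) l) as ρ → Run.write e is as ρ ≡ write is as ρ
  write≡ e []       []       ρ = refl
  write≡ e (i ∷ is) (a ∷ as) ρ = write≡ e is as (ρ [ i ]≔ a)

  writeℕ : Vec (Fin r) k → ℕ → Vec (Word W) r → Vec (Word W) r
  writeℕ is a = write is (encode W k a)

  execOr : (e : Twist) → Maybe (Instr r k) → Run.State e → Run.State e × Maybe (ℕ × ℕ)
  execOr e mi σ = maybe′ (λ i → Run.exec e i σ) (σ , nothing) mi

  Agrees : (e : Twist) → Snapshot → Maybe (ℕ × ℕ) → Run.State e × Maybe (ℕ × ℕ) → Set
  Agrees e C o (σ , o′) = Matches e C σ × o′ ≡ o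

  -- The order of quantifiers matters: the next snapshot and the output are fixed before `e`, hence
  -- common to all twists outside `h`.
  Simulates : Maybe (Instr r k) → Snapshot → Set
  Simulates mi C = ∃[ h ] ∃[ C′ ] ∃[ o ] length h ≤ 1 ×
    (∀ e → twisted e ∉ h → ∀ {σ} → Matches e C σ → Agrees e C′ o (execOr e mi σ))

  simulate-neighbour : ∀ is a p ρ μ c mv → (∀ e → Run.vertexAt e ρ a ≡ mv) →
                       Simulates (just (neighbour is a)) (snapshot p ρ μ c)
  simulate-neighbour is a p ρ μ c nothing at =
    [] , snapshot (suc p) (writeℕ is 0 ρ) μ c , nothing , z≤n ,
    λ { e _ (matches {q = q} q≡) → subst (Agrees e _ nothing)
          (sym (trans (exec-neighbour-nothing wordSize P (inputOf e) is a ρ (at e))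
            (cong (λ ρ′ → Run.state (suc p) ρ′ μ q , nothing) (write≡ e is _ ρ))))
          (matches q≡ , refl) }
  simulate-neighbour is a p ρ μ c (just v) at with nextNeighbour s v (c v)
  ... | h , next , h≤1 , same =
    -- The counter also grows on an exhausted list, just as `exec` still drops an entry there;
    -- dropping past the end leaves the empty list.
    h , snapshot (suc p) (writeℕ is (maybe′ label 0 next) ρ) μ (updateAt c v (_+ 1)) , nothing , h≤1 ,
    λ { e e∉ (matches {q = q} q≡) → subst (Agrees e _ nothing)
          (sym (trans (exec-neighbour-just wordSize P (inputOf e) is a ρ (at e))
            (cong (λ ρ′ → Run.state (suc p) ρ′ μ (updateAt q v (drop 1)) , nothing)
              (trans (write≡ e is _ ρ)
                     (cong (λ x → writeℕ is (maybe′ label 0 x) ρ) (trans (cong head (q≡ v)) (same e e∉)))))))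
          (matches (unread′ e q≡) , refl) }
    where
    unread′ : ∀ e {q} → (∀ u → q u ≡ unreadAfter e c u) →
              ∀ u → updateAt q v (drop 1) u ≡ unreadAfter e (updateAt c v (_+ 1)) u
    unread′ e {q} q≡ u with u ≟ v
    ... | yes refl rewrite updateAt-updates v {drop 1} q | updateAt-updates v {_+ 1} c | q≡ v =
      drop-drop (c v) 1 (neighboursOf e v)
    ... | no u≢v rewrite updateAt-minimal u v {drop 1} q u≢v | updateAt-minimal u v {_+ 1} c u≢v = q≡ u

  simulate : ∀ mi C → Simulates mi C
  simulate nothing C = [] , C , nothing , z≤n , λ { e _ M → M , refl }
  simulate (just (op f i j l)) (snapshot p ρ μ c) =
    [] , snapshot (suc p) _ _ c , nothing , z≤n ,
    λ { e _ (matches q) → matches q , refl }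
  simulate (just (load i a)) (snapshot p ρ μ c) =
    [] , snapshot (suc p) (ρ [ i ]≔ μ (Vec.map (lookup ρ) a)) _ c , nothing , z≤n ,
    λ { e _ (matches q) → matches q , refl }
  simulate (just (store a i)) (snapshot p ρ μ c) =
    [] , snapshot (suc p) _ (λ b → if does (≡-dec _≟_ b (Vec.map (lookup ρ) a)) then lookup ρ i else μ b)
         c , nothing , z≤n ,
    λ { e _ (matches q) → matches q , refl }
  simulate (just (jumpZero i t)) (snapshot p ρ μ c) =
    [] , snapshot (if toℕ (lookup ρ i) ≡ᵇ 0 then t else suc p) _ _ c , nothing , z≤n ,
    λ { e _ (matches q) → matches q , refl }
  simulate (just (order is)) (snapshot p ρ μ c) =
    [] , snapshot (suc p) (writeℕ is size ρ) μ c , nothing , z≤n ,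
    λ { e _ (matches q) → subst (λ ρ′ → Matches e _ (Run.state (suc p) ρ′ μ _))
          (sym (write≡ e is _ ρ)) (matches q) , refl }
  -- Every list has `suc s` entries whatever the twist, so degree queries reveal nothing.
  simulate (just (degree is a)) (snapshot p ρ μ c) =
    [] , snapshot (suc p) (writeℕ is (maybe′ (λ _ → suc s) 0 v?) ρ) μ c , nothing , z≤n ,
    λ { e _ {σ} (matches q) → subst (λ ρ′ → Matches e _ (Run.state (suc p) ρ′ μ _))
          (sym (trans (write≡ e is _ ρ) (cong (λ d → writeℕ is d ρ) (degrees e v?)))) (matches q) , refl }
    where
    v? = fromLabel size (decode W (Vec.map (lookup ρ) a))
    degrees : ∀ e mv → maybe′ (length ∘ neighboursOf e) 0 mv ≡ maybe′ (λ _ → suc s) 0 mv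
    degrees e nothing = refl
    degrees e (just v) = length-tabulate (λ j → code (link e (coords v) j))
  simulate (just (neighbour is a)) (snapshot p ρ μ c) =
    simulate-neighbour is a p ρ μ c (fromLabel size (decode W (Vec.map (lookup ρ) a))) (λ _ → refl)
  simulate (just (emit a b)) (snapshot p ρ μ c) =
    [] , snapshot (suc p) ρ μ c , _ , z≤n , λ { e _ (matches q) → matches q , refl }

  -- Each step adds at most one base edge to `H`. Twists outside `H` pass through the same
  -- snapshots, hence emit the same pairs.
  run : ∀ t C → ∃[ H ] ∃[ O ] length H ≤ t ×
    (∀ e → twisted e ∉ H → ∀ {σ} → Matches e C σ → Run.emitted e t σ ≡ O)
  run zero    C = [] , [] , z≤n , λ _ _ _ → refl
  run (suc t) C with simulate (head (drop (Snapshot.pc C) (Program.code P))) C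
  ... | h , C′ , o , h≤1 , agree with run t C′
  ...   | H , O , H≤t , same =
    h ++ H , fromMaybe o ++ O ,
    ≤-trans (≤-reflexive (length-++ h)) (+-mono-≤ h≤1 H≤t) ,
    λ { e e∉ M@(matches _) → let (M′ , o≡) = agree e (e∉ ∘ ∈-++⁺ˡ) M in
          cong₂ _++_ (cong fromMaybe o≡) (same e (e∉ ∘ ∈-++⁺ʳ h) M′) }

  initial : Snapshot
  initial = snapshot 0 (Vec.replicate r (toWord W 0)) (λ _ → toWord W 0) (λ _ → 0)

  -- A complete output reveals the twist

  Emits : List (ℕ × ℕ) → Fin size → Fin size → Set
  Emits os u v = (label u , label v) ∈ os

  label-injective : ∀ {n} {u v : Fin n} → label u ≡ label v → u ≡ v
  label-injective = toℕ-injective ∘ suc-injective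

  emits⇒adj : ∀ e {os u v} → Run.SpanningTreeOutput e os → Emits os u v → Graph.Adj (graphOf e) u v
  emits⇒adj e {os} {u} {v} (T , es , (sub , _) , (_ , adj) , refl) uv∈
    with ∈-map⁻ (Product.map label label) uv∈
  ... | (u′ , v′) , ∈es , eq
    with refl ← label-injective (cong proj₁ eq) | refl ← label-injective (cong proj₂ eq) =
    sub (Equivalence.from (adj u v) (inj₁ ∈es))

  sheetOf : Fin size → Bool
  sheetOf = sheet ∘ coords

  -- The tree connects a vertex of one sheet to a vertex of the other, so some tree edge changes the
  -- sheet.
  emitsBridge : ∀ e {os} → Run.SpanningTreeOutput e os →
                ∃[ u ] ∃[ v ] Emits os u v × sheetOf u ≢ sheetOf v
  emitsBridge e (T , es , (_ , connected , _) , (_ , adj) , refl)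
    with crossing Bool._≟_ sheetOf (connected a b) a≁b
    where
    a = code (false , false , zero)
    b = code (false , true , zero)
    a≁b : sheetOf a ≢ sheetOf b
    a≁b eq with trans (sym (cong sheet (coords-code (false , false , zero))))
                      (trans eq (cong sheet (coords-code (false , true , zero))))
    ... | ()
  ... | u , v , uv , u≁v with Equivalence.to (adj u v) uv
  ...   | inj₁ ∈es = u , v , ∈-map⁺ _ ∈es , u≁v
  ...   | inj₂ ∈es = v , u , ∈-map⁺ _ ∈es , u≁v ∘ sym

  bridge-twisted : ∀ e {u v} → Graph.Adj (graphOf e) u v → sheetOf u ≢ sheetOf v →
    baseEdge (proj₁ (coords u)) (index (coords u)) (index (coords v)) ≡ twisted e
  bridge-twisted e {u} {v} uv u≁v = decidable-stable (_ ≟ₑ _) λ ne →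
    u≁v (sym (trans (cong sheet uv) (unflipped e (coords u) (index (coords v)) ne)))

  twists : List BaseEdge
  twists = List.map twisted (cartesianProduct (allFin s) (allFin s))

  twisted-injective : ∀ {e e′} → twisted e ≡ twisted e′ → e ≡ e′
  twisted-injective refl = refl

  twists-unique : Unique twists
  twists-unique = Unique.map⁺ twisted-injective (Unique.cartesianProduct⁺ (Unique.allFin⁺ s) (Unique.allFin⁺ s))

  length-twists : length twists ≡ s * s
  length-twists = trans (length-map twisted (cartesianProduct (allFin s) (allFin s)))
    (trans (length-cartesianProduct (allFin s) (allFin s)) (cong (λ k → k * k) (length-tabulate {n = s} (λ i → i))))

  freshTwist : ∀ H → length H < s * s → ∃[ e ] twisted e ∉ H
  freshTwist H H< with fresh-element _≟ₑ_ twists H twists-unique (≤-trans H< (≤-reflexive (sym length-twists)))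
  ... | f , f∈ , f∉ with ∈-map⁻ twisted f∈
  ...   | e , _ , refl = e , f∉

  -- The common output `O` of two surviving twists contains a bridge. It is an edge of both graphs
  -- and names the twisted edge of each, so the twists coincide. The summand 2 leaves room for a
  -- second twist, distinct from the first.
  no-common-bound : ∀ t → 2 + t ≤ s * s →
    ¬ (∀ e → Run.SpanningTreeOutput e (Run.emitted e t (Run.start e)))
  no-common-bound t t< output with run t initial
  ... | H , O , H≤t , same
    with e , e∉ ← freshTwist H (≤-trans (s≤s (≤-trans H≤t (n≤1+n t))) t<)
    with e′ , e′∉ ← freshTwist (twisted e ∷ H) (≤-trans (s≤s (s≤s H≤t)) t<) =
    e′∉ (here (trans (sym (bridge-twisted e′ uv′ u≁v)) (bridge-twisted e uv u≁v)))
    where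
    treeOf : ∀ e → twisted e ∉ H → Run.SpanningTreeOutput e O
    treeOf e e∉ = subst (Run.SpanningTreeOutput e) (same e e∉ (matches λ _ → refl)) (output e)
    tree = treeOf e e∉
    bridge = emitsBridge e tree
    uv∈ = proj₁ (proj₂ (proj₂ bridge))
    u≁v = proj₂ (proj₂ (proj₂ bridge))
    uv = emits⇒adj e tree uv∈
    uv′ = emits⇒adj e′ (treeOf e′ (e′∉ ∘ there)) uv∈

-- From time and delay bounds to the output at a fixed time

module _ (wordSize : ℕ → ℕ) (P : Program) (x : Input) where
  open Execution wordSize P x hiding (ComputesSpanningTreeIn; EnumeratesSpanningTree)
  open Input x using (n)

  emitted-+ : ∀ a b σ → emitted (a + b) σ ≡ emitted a σ ++ emitted b (after a σ)
  emitted-+ zero    b σ = refl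
  emitted-+ (suc a) b σ =
    trans (cong (fromMaybe (proj₂ (step σ)) ++_) (emitted-+ a b (proj₁ (step σ))))
          (sym (++-assoc (fromMaybe (proj₂ (step σ))) _ _))

  halted⇒silent : ∀ t {σ} → Halted σ → emitted t σ ≡ []
  halted⇒silent zero    h = refl
  halted⇒silent (suc t) h rewrite h = halted⇒silent t h

  -- Nothing is emitted after halting. So the output may be read at one time `T` for all twists,
  -- although their running times may differ.
  computes⇒output : ∀ {t T} → t ≤ T → ComputesSpanningTreeIn wordSize P x t →
                    SpanningTreeOutput (emitted T start)
  computes⇒output {t} t≤T (halted , output) with m≤n⇒∃[o]m+o≡n t≤T
  ... | k , refl = subst SpanningTreeOutput (sym (trans (emitted-+ t k start)
    (trans (cong (emitted t start ++_) (halted⇒silent k halted)) (++-identityʳ _)))) output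

  emitted-next : ∀ t {o σ} → emitted t σ ≡ [] → proj₂ (step (after t σ)) ≡ just o →
                 emitted (suc t) σ ≡ o ∷ []
  emitted-next t {o} {σ} silent emits = trans (cong (λ k → emitted k σ) (+-comm 1 t))
    (trans (emitted-+ t 1 σ) (cong₂ _++_ silent (cong (λ m → fromMaybe m ++ []) emits)))

  -- Each pair uses up at most `d` steps of the budget `T`; the induction continues with the budget
  -- that remains. After the last pair the program stays silent.
  delay⇒emitted : ∀ {d σ os} → EmitsWithDelay d σ os → ∀ T → length os * d ≤ T → emitted T σ ≡ os
  delay⇒emitted (done silent) T _ = silent T
  delay⇒emitted {d} {σ} (next t {o} {os} t<d silent emits rest) T le
    with m≤n⇒∃[o]m+o≡n (≤-trans t<d (m+n≤o⇒m≤o d le))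
  ... | k , refl = trans (emitted-+ (suc t) k σ)
    (cong₂ _++_ (emitted-next t silent emits)
      (delay⇒emitted rest k (+-cancelˡ-≤ (suc t) _ _ (≤-trans (+-monoˡ-≤ _ t<d) le))))

  enumerates⇒output : ∀ p d {T} → p + n * d ≤ T → EnumeratesSpanningTree wordSize P x p d →
                      SpanningTreeOutput (emitted T start)
  enumerates⇒output p d le (silent , os , output@(T , es , (_ , _ , acyclic) , listed , refl) , emits)
    with m≤n⇒∃[o]m+o≡n (m+n≤o⇒m≤o p le)
  ... | k , refl = subst SpanningTreeOutput (sym (trans (emitted-+ p k start)
      (cong₂ _++_ silent (delay⇒emitted emits k
        (≤-trans (*-monoˡ-≤ d length≤n) (+-cancelˡ-≤ p _ _ le)))))) output
    where
    length≤n : length os ≤ n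
    -- The pairs are the edges of a forest on `n` vertices, so at most `n` delays occur.
    length≤n = ≤-trans (≤-reflexive (length-map _ es)) (forest-size T acyclic listed)

-- Rational inequalities and the growth of the parameters

eventually : ∀ N → ∃[ K ] (∀ a b → K * suc b ≤ a → N ℚ.≤ (+ a) ℚ./ suc b)
-- A fraction with numerator `p` and positive integer denominator is at most the absolute value of
-- `p`, which serves as threshold.
eventually (mkℚᵘ p d) = ℤ.∣ p ∣ , λ a b le → ℚ.*≤* (begin
  p ℤ.* + suc b           ≤⟨ ℤ.*-monoʳ-≤-nonNeg (+ suc b) (i≤∣i∣ p) ⟩
  + ℤ.∣ p ∣ ℤ.* + suc b   ≡⟨ ℤ.pos-* ℤ.∣ p ∣ (suc b) ⟨
  + (ℤ.∣ p ∣ * suc b)     ≤⟨ ℤ.+≤+ (≤-trans le (m≤m*n a (suc d))) ⟩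
  + (a * suc d)           ≡⟨ ℤ.pos-* a (suc d) ⟩
  + a ℤ.* + suc d         ∎)
  where
  open ℤ.≤-Reasoning
  i≤∣i∣ : ∀ i → i ℤ.≤ + ℤ.∣ i ∣
  i≤∣i∣ (+ k)      = ℤ.≤-refl
  i≤∣i∣ (-[1+ k ]) = ℤ.-≤+

scaled-≤ : ∀ f a b c → (+ f) ℚ./ 1 ℚ.≤ (+ 1 ℚ./ suc c) ℚ.* ((+ a) ℚ./ suc b) → f * (suc c * suc b) ≤ a
scaled-≤ f a b c (ℚ.*≤* le) = ℤ.drop‿+≤+ (subst₂ ℤ._≤_ (sym (ℤ.pos-* f (suc c * suc b)))
  (trans (ℤ.*-identityʳ _) (ℤ.*-identityˡ (+ a))) le)

module _ (s : ℕ) where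
  open DoubleCover s

  s<edgeCount : ∀ e → suc s ≤ edgeCount (graphOf e)
  s<edgeCount e = ≤-trans (≤-reflexive (sym (length-tabulate (λ j → code (link e (coords zero) j)))))
    (distinctNeighbours≤edgeCount (graphOf e) (neighboursOf-unique e zero) (neighboursOf-sound e))

  s<deg : ∀ e u → suc s ≤ deg (graphOf e) u
  s<deg e u = ≤-trans (≤-reflexive (sym (length-tabulate (λ j → code (link e (coords u) j)))))
    (distinctNeighbours≤deg (graphOf e) (neighboursOf-unique e u) (neighboursOf-sound e))

  degreeSum : Twist → ℕ
  degreeSum e = sum (List.map (deg (graphOf e)) (allFin size))

  degreeSum-bounds : ∀ e → size * suc s ≤ degreeSum e × degreeSum e ≤ size * size
  degreeSum-bounds e = subst (λ k → k * suc s ≤ degreeSum e × degreeSum e ≤ k * size)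
    (length-tabulate {n = size} (λ i → i))
    (sum-bounds (deg (graphOf e)) (s<deg e) (deg≤size (graphOf e)) (allFin size))

  m-large : ∀ {N} e → proj₁ (eventually N) ≤ suc s → N ℚ.≤ m (inputOf e)
  m-large {N} e le = proj₂ (eventually N) _ 0
    (≤-trans (≤-reflexive (*-identityʳ _)) (≤-trans le (s<edgeCount e)))

  Δ̄-large : ∀ {N} e → proj₁ (eventually N) ≤ suc s → N ℚ.≤ Δ̄ (inputOf e)
  Δ̄-large {N} e le = proj₂ (eventually N) _ _
    (≤-trans (*-monoˡ-≤ size le) (≤-trans (≤-reflexive (*-comm (suc s) size)) (proj₁ (degreeSum-bounds e))))

  ≤m⇒ : ∀ c e f → (+ f) ℚ./ 1 ℚ.≤ (+ 1 ℚ./ suc c) ℚ.* m (inputOf e) → suc c * f ≤ size * size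
  ≤m⇒ c e f le = begin
    suc c * f             ≡⟨ *-comm (suc c) f ⟩
    f * suc c             ≡⟨ cong (f *_) (*-identityʳ (suc c)) ⟨
    f * (suc c * 1)       ≤⟨ scaled-≤ f _ 0 c le ⟩
    edgeCount (graphOf e) ≤⟨ edgeCount≤size² (graphOf e) ⟩
    size * size           ∎
    where open ≤-Reasoning

  -- The factor `size`, which will count the delays, cancels the denominator of the average degree
  -- and leaves the degree sum.
  ≤Δ̄⇒ : ∀ c e f → (+ f) ℚ./ 1 ℚ.≤ (+ 1 ℚ./ suc c) ℚ.* Δ̄ (inputOf e) →
         suc c * (size * f) ≤ size * size
  ≤Δ̄⇒ c e f le = begin
    suc c * (size * f) ≡⟨ trans (sym (*-assoc (suc c) size f)) (*-comm _ f) ⟩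
    f * (suc c * size) ≤⟨ scaled-≤ f (degreeSum e) _ c le ⟩
    degreeSum e        ≤⟨ proj₂ (degreeSum-bounds e) ⟩
    size * size        ∎
    where open ≤-Reasoning

-- Choice of the size

module Scale (k : ℕ) where
  -- `k` is the threshold past which the asymptotic bounds apply. The times will be at most `r * r`
  -- each, and `s = 2 * r` gives `4 * (r * r)` twists, more than two such times can exclude.
  r s : ℕ
  r = suc k
  s = 2 * r

  open DoubleCover s using (size)

  k≤ : k ≤ suc s
  k≤ = ≤-trans (n≤1+n k) (≤-trans (m≤m+n r (r + 0)) (n≤1+n s))

  size²≤ : size * size ≤ 144 * (r * r)
  size²≤ = begin
    size * size           ≤⟨ *-mono-≤ size≤ size≤ ⟩
    (12 * r) * (12 * r)   ≡⟨ square r ⟩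
    144 * (r * r)         ∎
    where
    open ≤-Reasoning
    square : ∀ r → (12 * r) * (12 * r) ≡ 144 * (r * r)
    square = solve-∀
    expand : ∀ k → 2 * (2 * suc (2 * suc k)) + 4 * k ≡ 12 * suc k
    expand = solve-∀
    -- Here `size` is `8 * r + 4`, and `r` is at least 1.
    size≤ : size ≤ 12 * r
    size≤ = ≤-trans (m≤m+n size (4 * k)) (≤-reflexive (expand k))

  small : ∀ f → 144 * f ≤ size * size → f ≤ r * r
  small f le = *-cancelˡ-≤ 144 (≤-trans le size²≤)

  time<pairs : 2 + (r * r + r * r) ≤ s * s
  time<pairs = ≤-trans (m≤m+n _ (4 * k + 2 * (k * k))) (≤-reflexive (expand k))
    where
    expand : ∀ k → 2 + (suc k * suc k + suc k * suc k) + (4 * k + 2 * (k * k)) ≡ (2 * suc k) * (2 * suc k)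
    expand = solve-∀

-- The two lower bounds

-- The denominator is 12², from size ≤ 12 r.
1/144 : ℚᵘ
1/144 = + 1 ℚ./ 144

0<1/144 : ℚ.0ℚᵘ ℚ.< 1/144
0<1/144 = ℚ.*<* (ℤ.+<+ (s≤s z≤n))

theorem1 : (w : ℕ → ℕ) → w ∈Ωlog →
    ((P : Program) → ¬ ComputesInTimeo[m] w P) ×
    ((P : Program) → ¬ EnumeratesWithPreprocessingo[m]Delayo[Δ̄] w P)
theorem1 w _ = no-computation , no-enumeration
  where
  no-computation : (P : Program) → ¬ ComputesInTimeo[m] w P
  no-computation P (time , time∈o , computes) = no-common-bound (r * r + r * r) time<pairs λ e →
    computes⇒output w P (inputOf e)
      (≤-trans (small (time (inputOf e)) (≤m⇒ s 143 e (time (inputOf e)) (fast (inputOf e) (m-large s e k≤)))) (m≤m+n (r * r) (r * r)))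
      (computes (inputOf e))
    where
    bound = time∈o 1/144 0<1/144
    fast = proj₂ bound
    open Scale (proj₁ (eventually (proj₁ bound)))
    open DoubleCover s
    open Simulation w P s

  no-enumeration : (P : Program) → ¬ EnumeratesWithPreprocessingo[m]Delayo[Δ̄] w P
  no-enumeration P (prep , delay , prep∈o , delay∈o , enumerates) =
    no-common-bound (r * r + r * r) time<pairs λ e →
      enumerates⇒output w P (inputOf e) (prep (inputOf e)) (delay (inputOf e))
        -- Preprocessing takes one share `r * r` of the time, all delays together the other. The
        -- argument 143 stands for the denominator 144.
        (+-mono-≤ (small (prep (inputOf e)) (≤m⇒ s 143 e (prep (inputOf e)) (proj₂ prepBound (inputOf e) (m-large s e (≤-trans (m≤m+n _ _) k≤)))))
                  (small (size * delay (inputOf e)) (≤Δ̄⇒ s 143 e (delay (inputOf e)) (proj₂ delayBound (inputOf e) (Δ̄-large s e (≤-trans (m≤n+m _ _) k≤))))))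
        (enumerates (inputOf e))
    where
    prepBound = prep∈o 1/144 0<1/144
    delayBound = delay∈o 1/144 0<1/144
    -- The sum of the two thresholds exceeds neither less than the other requires: it is at least
    -- each of them, so both bounds apply.
    open Scale (proj₁ (eventually (proj₁ prepBound)) + proj₁ (eventually (proj₁ delayBound)))
    open DoubleCover s
    open Simulation w P s
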